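{- The satisfiability problem for linear HyperPDL-$\Delta$ (given a linear HyperPDL-$\Delta$ formula $\varphi$, decide whether there is a non-empty set of traces $T$ with $T\models\varphi$) is undecidable.
   Context: Let $AP$ be a finite set of atomic propositions and $\Sigma$ a finite set of atomic programs. A trace is an infinite alternating sequence $t\in(2^{AP}\Sigma)^\omega$; positions are counted in this alternating sequence (even positions carry sets of propositions, odd positions carry programs). HyperPDL-$\Delta$ formulas: $\varphi::=\exists\pi.\varphi\mid\forall\pi.\varphi\mid a_\pi\mid\neg\varphi\mid\varphi\wedge\varphi\mid\varphi\vee\varphi\mid\langle\alpha\rangle\varphi\mid[\alpha]\varphi\mid\Delta\alpha$, programs $\alpha::=\tau\mid\varepsilon\mid\alpha+\alpha\mid\alpha\cdot\alpha\mid\alpha^*\mid\varphi?$, with $a\in AP$, $\tau\in(\Sigma\cup\{\cdot\})^n$ where $n$ is the number of enclosing quantifiers (binding $\pi_1,\dots,\pi_n$ in order of nesting; component $l$ refers to $\pi_l$; $\cdot$ a wildcard). A linear HyperPDL-$\Delta$ formula has the form $Q_1\pi_1\dots Q_n\pi_n.\psi$ with $Q_i\in\{\exists,\forall\}$ and $\psi$ quantifier-free. Semantics over a set of traces $T$: a trace assignment $\Pi$ maps the variables $\pi_1,\dots,\pi_n$ to (suffixes of) traces in $T$, $\Pi[i,\infty]$ shifts all of them by $i$. $\Pi\models\exists\pi.\varphi$ iff some $t\in T$ has $\Pi[\pi\to t]\models\varphi$; $\forall$ dually; $\Pi\models a_\pi$ iff $a\in\Pi(\pi)(0)$; Boolean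 connectives standard; $\langle\alpha\rangle\varphi$: some $i$ with $(\Pi,0,i)\in R(\alpha)$ and $\Pi[i,\infty]\models\varphi$; $[\alpha]\varphi$: all such $i$ have $\Pi[i,\infty]\models\varphi$; $\Delta\alpha$: there are $0=k_1\le k_2\le\dots$ with $(\Pi,k_j,k_{j+1})\in R(\alpha)$ for all $j$. $(\Pi,i,k)\in R(\tau)$ iff $k=i+2$ and each $\tau|_l$ is $\cdot$ or equals $\Pi(\pi_l)(i+1)$; $R(\varepsilon)$: $i=k$; $R(\alpha_1+\alpha_2)=R(\alpha_1)\cup R(\alpha_2)$; $(\Pi,i,k)\in R(\alpha_1\cdot\alpha_2)$ iff some $i\le j\le k$ has $(\Pi,i,j)\in R(\alpha_1)$ and $(\Pi,j,k)\in R(\alpha_2)$; $(\Pi,i,k)\in R(\alpha^*)$ iff there are $i=j_0\le\dots\le j_l=k$ with all $(\Pi,j_m,j_{m+1})\in R(\alpha)$; $(\Pi,i,k)\in R(\varphi?)$ iff $i=k$ and $\Pi[i,\infty]\models\varphi$. $T\models\varphi$ iff the empty assignment satisfies $\varphi$ over $T$. -}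

module Defs where

open import Data.Nat using (ℕ; zero; suc; _≤_; _+_)
open import Data.Fin using (Fin; toℕ) renaming (zero to fzero; suc to fsuc)
open import Data.Bool using (Bool; true; false)
open import Data.Maybe using (Maybe; just; nothing)
open import Data.Vec using (Vec; []; _∷_)
open import Data.List using (List; []; _∷_; _++_; replicate)
open import Data.Product using (Σ; _×_; _,_)
open import Data.Sum using (_⊎_; inj₁; inj₂)
open import Data.Integer using (ℤ; +_; -[1+_]) renaming (_+_ to _+ℤ_)
open import Relation.Nullary using (¬_)
open import Relation.Binary.PropositionalEquality using (_≡_)
open import Relation.Binary.Construct.Closure.ReflexiveTransitive using (Star)

-- Traces over AP = Fin nAP and Σ = Fin nΣ.
-- A trace t ∈ (2^AP Σ)^ω is represented by its two interleaved streams: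
-- props j = t(2j) ∈ 2^AP  and  prog j = t(2j+1) ∈ Σ.
-- Since programs only ever move by 0 or 2 positions from position 0,
-- all relevant positions are even; "state index j" stands for position 2j.

record Trace (nAP nΣ : ℕ) : Set where
  field
    props : ℕ → Fin nAP → Bool
    prog  : ℕ → Fin nΣ

open Trace public

-- Trace assignment for the n variables π₁ … πₙ (index l ↦ π_{l+1}).
Assignment : ℕ → ℕ → ℕ → Set
Assignment nAP nΣ n = Fin n → Trace nAP nΣ

mutual
  data Form (nAP nΣ n : ℕ) : Set where
    atom : Fin nAP → Fin n → Form nAP nΣ n
    ¬f   : Form nAP nΣ n → Form nAP nΣ n
    _∧f_ : Form nAP nΣ n → Form nAP nΣ n → Form nAP nΣ n
    _∨f_ : Form nAP nΣ n → Form nAP nΣ n → Form nAP nΣ n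
    ⟨_⟩_ : Prog nAP nΣ n → Form nAP nΣ n → Form nAP nΣ n
    [_]_ : Prog nAP nΣ n → Form nAP nΣ n → Form nAP nΣ n
    Δ    : Prog nAP nΣ n → Form nAP nΣ n

  data Prog (nAP nΣ n : ℕ) : Set where
    τ    : Vec (Maybe (Fin nΣ)) n → Prog nAP nΣ n        -- nothing = wildcard ·
    ε    : Prog nAP nΣ n
    _+p_ : Prog nAP nΣ n → Prog nAP nΣ n → Prog nAP nΣ n
    _·p_ : Prog nAP nΣ n → Prog nAP nΣ n → Prog nAP nΣ n
    _*p  : Prog nAP nΣ n → Prog nAP nΣ n
    _¿   : Form nAP nΣ n → Prog nAP nΣ n

data Quant : Set where
  ∃q ∀q : Quant

-- A linear formula Q₁π₁ … Qₙπₙ. ψ  (Q₁ outermost, binding π₁).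
record LinFormula (nAP nΣ : ℕ) : Set where
  constructor lin
  field
    n      : ℕ
    prefix : Vec Quant n
    body   : Form nAP nΣ n

-- Semantics.  sat φ Π j  means  Π[2j,∞] ⊨ φ ;
-- R α Π i k  means  (Π,2i,2k) ∈ R(α).

MatchStep : ∀ {nAP nΣ n} → Vec (Maybe (Fin nΣ)) n → Assignment nAP nΣ n → ℕ → Set
MatchStep [] Π i = Data.Unit.⊤ where import Data.Unit
MatchStep (nothing ∷ v) Π i = MatchStep v (λ l → Π (fsuc l)) i
MatchStep (just a ∷ v) Π i = (prog (Π fzero) i ≡ a) × MatchStep v (λ l → Π (fsuc l)) i

mutual
  sat : ∀ {nAP nΣ n} → Form nAP nΣ n → Assignment nAP nΣ n → ℕ → Set
  sat (atom a π) Π j = props (Π π) j a ≡ true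
  sat (¬f φ) Π j = ¬ sat φ Π j
  sat (φ ∧f ψ) Π j = sat φ Π j × sat ψ Π j
  sat (φ ∨f ψ) Π j = sat φ Π j ⊎ sat ψ Π j
  sat (⟨ α ⟩ φ) Π j = Σ ℕ λ k → R α Π j k × sat φ Π k
  sat ([ α ] φ) Π j = ∀ k → R α Π j k → sat φ Π k
  sat (Δ α) Π j = Σ (ℕ → ℕ) λ k → (k 0 ≡ j) × (∀ m → R α Π (k m) (k (suc m)))

  R : ∀ {nAP nΣ n} → Prog nAP nΣ n → Assignment nAP nΣ n → ℕ → ℕ → Set
  R (τ v) Π i k = (k ≡ suc i) × MatchStep v Π i
  R ε Π i k = i ≡ k
  R (α +p β) Π i k = R α Π i k ⊎ R β Π i k
  R (α ·p β) Π i k = Σ ℕ λ j → (i ≤ j) × (j ≤ k) × R α Π i j × R β Π j k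
  R (α *p) Π i k = Star (R α Π) i k
  R (φ ¿) Π i k = (i ≡ k) × sat φ Π i

consA : ∀ {nAP nΣ m} → Trace nAP nΣ → Assignment nAP nΣ m → Assignment nAP nΣ (suc m)
consA t Π fzero = t
consA t Π (fsuc l) = Π l

evalPrefix : ∀ {nAP nΣ m} → (Trace nAP nΣ → Set) → Vec Quant m →
             (Assignment nAP nΣ m → Set) → Set
evalPrefix T [] P = P (λ ())
evalPrefix T (∃q ∷ qs) P = Σ (Trace _ _) λ t → T t × evalPrefix T qs (λ Π → P (consA t Π))
evalPrefix T (∀q ∷ qs) P = ∀ t → T t → evalPrefix T qs (λ Π → P (consA t Π))

_⊨_ : ∀ {nAP nΣ} → (Trace nAP nΣ → Set) → LinFormula nAP nΣ → Set
T ⊨ lin n qs ψ = evalPrefix T qs (λ Π → sat ψ Π 0)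

record Instance : Set where
  constructor inst
  field
    nAP nΣ  : ℕ
    formula : LinFormula nAP nΣ

Satisfiable : Instance → Set₁
Satisfiable (inst nAP nΣ φ) =
  Σ (Trace nAP nΣ → Set) λ T → (Σ (Trace nAP nΣ) T) × (T ⊨ φ)

-- Encoding of instances as binary words (prefix-free, injective).

encℕ : ℕ → List Bool
encℕ n = replicate n true ++ (false ∷ [])

encFin : ∀ {k} → Fin k → List Bool
encFin i = encℕ (toℕ i)

encMaybe : ∀ {k} → Maybe (Fin k) → List Bool
encMaybe nothing = false ∷ []
encMaybe (just a) = true ∷ encFin a

encVec : ∀ {A : Set} {n} → (A → List Bool) → Vec A n → List Bool
encVec e [] = []
encVec e (x ∷ v) = e x ++ encVec e v

encQuant : Quant → List Bool
encQuant ∃q = false ∷ []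
encQuant ∀q = true ∷ []

mutual
  encForm : ∀ {nAP nΣ n} → Form nAP nΣ n → List Bool
  encForm (atom a π) = encℕ 0 ++ encFin a ++ encFin π
  encForm (¬f φ) = encℕ 1 ++ encForm φ
  encForm (φ ∧f ψ) = encℕ 2 ++ encForm φ ++ encForm ψ
  encForm (φ ∨f ψ) = encℕ 3 ++ encForm φ ++ encForm ψ
  encForm (⟨ α ⟩ φ) = encℕ 4 ++ encProg α ++ encForm φ
  encForm ([ α ] φ) = encℕ 5 ++ encProg α ++ encForm φ
  encForm (Δ α) = encℕ 6 ++ encProg α

  encProg : ∀ {nAP nΣ n} → Prog nAP nΣ n → List Bool
  encProg (τ v) = encℕ 0 ++ encVec encMaybe v
  encProg ε = encℕ 1
  encProg (α +p β) = encℕ 2 ++ encProg α ++ encProg β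
  encProg (α ·p β) = encℕ 3 ++ encProg α ++ encProg β
  encProg (α *p) = encℕ 4 ++ encProg α
  encProg (φ ¿) = encℕ 5 ++ encForm φ

encInstance : Instance → List Bool
encInstance (inst nAP nΣ (lin n qs ψ)) =
  encℕ nAP ++ encℕ nΣ ++ encℕ n ++ encVec encQuant qs ++ encForm ψ

-- Deterministic single-tape Turing machines over the input alphabet Bool.
-- Tape symbols: Fin (3 + g), with 0 = blank, 1 = false, 2 = true.

data Move : Set where
  left right stay : Move

data Action (q s : ℕ) : Set where
  halt  : Bool → Action q s                             -- accept (true) / reject (false)
  write : Fin q → Fin s → Move → Action q s

record TM : Set where
  field
    nStates : ℕ                                         -- states Fin (suc nStates), start = 0
    nExtra  : ℕ
    δ : Fin (suc nStates) → Fin (3 + nExtra) → Action (suc nStates) (3 + nExtra)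

module _ (M : TM) where
  open TM M

  Sym : Set
  Sym = Fin (3 + nExtra)

  record Config : Set where
    constructor cfg
    field
      state : Fin (suc nStates)
      tape  : ℤ → Sym
      head  : ℤ

  encBit : Bool → Sym
  encBit false = fsuc fzero
  encBit true  = fsuc (fsuc fzero)

  inputTape : List Bool → ℤ → Sym
  inputTape []      _              = fzero
  inputTape (b ∷ w) (+ zero)       = encBit b
  inputTape (b ∷ w) (+ (suc n))    = inputTape w (+ n)
  inputTape (b ∷ w) -[1+ n ]       = fzero

  initial : List Bool → Config
  initial w = cfg fzero (inputTape w) (+ 0)

  moveBy : Move → ℤ → ℤ
  moveBy left  h = h +ℤ -[1+ 0 ]
  moveBy right h = h +ℤ + 1
  moveBy stay  h = h

  update : (ℤ → Sym) → ℤ → Sym → ℤ → Sym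
  update f h a x with x Data.Integer.≟ h
  ... | Relation.Nullary.yes _ = a
  ... | Relation.Nullary.no  _ = f x

  step : Config → Bool ⊎ Config
  step (cfg s f h) with δ s (f h)
  ... | halt b = inj₁ b
  ... | write s' a m = inj₂ (cfg s' (update f h a) (moveBy m h))

  run : ℕ → Config → Bool ⊎ Config
  run zero c = inj₂ c
  run (suc n) c with step c
  ... | inj₁ b  = inj₁ b
  ... | inj₂ c' = run n c'

  HaltsWith : List Bool → Bool → Set
  HaltsWith w b = Σ ℕ λ n → run n (initial w) ≡ inj₁ b

Decides : TM → (Instance → Set₁) → Set₁
Decides M P = ∀ x → (P x → HaltsWith M (encInstance x) true)
                  × (¬ P x → HaltsWith M (encInstance x) false)

Undecidable : (Instance → Set₁) → Set₁
Undecidable P = ¬ (Σ TM λ M → Decides M P)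

{-# OPTIONS --safe #-}
module Submission where

-- Given a machine M, we build a formula φ = ∃π₀∀π₁∃π₂. ψ that is satisfiable if M
-- rejects enc φ and unsatisfiable if M accepts it.  Traces are configurations of
-- a three-stack machine: π₀ is the initial one, π₂ is a successor of π₁, and π₁ is
-- not accepting.  The self-reference is a quine: φ spells a word B letter by
-- letter on π₀, so enc φ = A ++ h(B) ++ B' where A does not depend on B, h maps
-- each letter to the code of the conjunct spelling it, and B', the code of the
-- remaining formula, mentions A and h but not B.  Choosing B = B', the stack
-- machine, started with A and B, first expands B to h(B), then rewinds to the
-- beginning of A ++ h(B) ++ B = enc φ and runs M, its tape split at the head into
-- two stacks.

open import Defs
open import Data.Nat using (ℕ; zero; suc; _+_; _*_)
open import Data.Nat.Properties using (+-suc; +-identityʳ)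
open import Data.Fin using (Fin; toℕ; _↑ˡ_; _↑ʳ_; splitAt; combine; remQuot) renaming (zero to fzero; suc to fsuc)
import Data.Fin as Fin
open import Data.Fin.Properties using (splitAt-↑ˡ; splitAt-↑ʳ; remQuot-combine)
open import Data.Bool using (Bool; true; false)
open import Data.Maybe using (nothing)
open import Data.Vec using (Vec; []; _∷_; zipWith) renaming (map to mapᵛ; lookup to lookupᵛ; replicate to replicateᵛ)
open import Data.Vec.Properties using (lookup-map; lookup-zipWith)
open import Data.Vec.Relation.Binary.Pointwise.Extensional using (ext; extensional⇒inductive)
open import Data.Vec.Relation.Binary.Pointwise.Inductive using (Pointwise-≡⇒≡)
open import Data.List using (List; []; _∷_; _++_; map; concatMap; reverse; drop; length; lookup)
open import Data.List.Properties using (++-assoc; reverse-++; reverse-involutive; map-++; reverse-map; unfold-reverse)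
open import Data.Product using (Σ; _×_; _,_; proj₁; proj₂)
open import Data.Sum using (_⊎_; inj₁; inj₂; [_,_]′)
open import Data.Sum.Properties using (inj₁-injective)
open import Data.Empty using (⊥-elim)
open import Data.Unit using (tt)
open import Data.Integer using (ℤ; +_; -[1+_]) renaming (_+_ to _+ℤ_)
import Data.Integer as ℤ
import Data.Integer.Properties as ℤₚ
open import Algebra.Properties.AbelianGroup ℤₚ.+-0-abelianGroup using (identityʳ-unique)
open import Function using (_∘_; _⇔_; mk⇔; Equivalence)
open import Relation.Nullary using (¬_; Dec; yes; no; does)
open import Relation.Nullary.Decidable using (dec-true)
open import Relation.Binary.PropositionalEquality hiding ([_])
open import Relation.Binary.Construct.Closure.ReflexiveTransitive using (Star; _◅_) renaming (ε to done)
open Equivalence using (to; from)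

private variable
  nAP nΣ n m : ℕ

infixr 5 _⇒f_

-- Derived temporal connectives and their semantics

tick : Prog nAP nΣ n
tick = τ (replicateᵛ _ nothing)

-- `tick` leads from each position to its successor and nowhere else, so box and diamond agree here.
next : Form nAP nΣ n → Form nAP nΣ n
next φ = [ tick ] φ

next^ : ℕ → Form nAP nΣ n → Form nAP nΣ n
next^ zero    φ = φ
next^ (suc k) φ = next^ k (next φ)

□_ : Form nAP nΣ n → Form nAP nΣ n
□ φ = [ tick *p ] φ

-- The test program gives the constructive implication, unlike ¬φ ∨ ψ.
_⇒f_ : Form nAP nΣ n → Form nAP nΣ n → Form nAP nΣ n
φ ⇒f ψ = [ φ ¿ ] ψ

-- The syntax has no constants; `Δ ε` is true because a sequence of positions that stays put
-- satisfies it.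
⊤f ⊥f : Form nAP nΣ n
⊤f = Δ ε
⊥f = ¬f ⊤f

⋀ : (Fin m → Form nAP nΣ n) → Form nAP nΣ n
⋀ {zero}  f = ⊤f
⋀ {suc m} f = f fzero ∧f ⋀ (f ∘ fsuc)

⋀ᵛ : ∀ {k} → (Vec (Fin m) k → Form nAP nΣ n) → Form nAP nΣ n
⋀ᵛ {k = zero}  f = f []
⋀ᵛ {k = suc k} f = ⋀ λ a → ⋀ᵛ λ v → f (a ∷ v)

module _ {nAP nΣ : ℕ} where

  match-any : (Π : Assignment nAP nΣ n) (i : ℕ) → MatchStep (replicateᵛ n nothing) Π i
  match-any {zero}  Π i = tt
  match-any {suc n} Π i = match-any (Π ∘ fsuc) i

  module _ {n : ℕ} {Π : Assignment nAP nΣ n} where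

    sat-⊤ : ∀ {j} → sat (⊤f {nAP} {nΣ} {n}) Π j
    sat-⊤ {j} = (λ _ → j) , refl , λ _ → refl

    sat-⇒ : ∀ {φ ψ : Form nAP nΣ n} {j} → sat (φ ⇒f ψ) Π j ⇔ (sat φ Π j → sat ψ Π j)
    sat-⇒ = mk⇔ (λ f p → f _ (refl , p)) (λ { f _ (refl , p) → f p })

    sat-next : ∀ (φ : Form nAP nΣ n) {j} → sat (next φ) Π j ⇔ sat φ Π (suc j)
    sat-next φ = mk⇔ (λ f → f _ (refl , match-any Π _)) (λ { p _ (refl , _) → p })

    sat-next^ : ∀ k (φ : Form nAP nΣ n) {j} → sat (next^ k φ) Π j ⇔ sat φ Π (k + j)
    sat-next^ zero    φ = mk⇔ (λ p → p) (λ p → p)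
    sat-next^ (suc k) φ = mk⇔ (to (sat-next φ) ∘ to (sat-next^ k (next φ)))
                              (from (sat-next^ k (next φ)) ∘ from (sat-next φ))

    ticks : ∀ i {j} → Star (R tick Π) j (j + i)
    ticks zero    {j} rewrite +-identityʳ j = done
    ticks (suc i) {j} rewrite +-suc j i = (refl , match-any Π _) ◅ ticks i

    ticks⁻¹ : ∀ {j k} → Star (R tick Π) j k → Σ ℕ λ i → k ≡ j + i
    ticks⁻¹ {j} done = 0 , sym (+-identityʳ j)
    ticks⁻¹ {j} ((refl , _) ◅ s) with ticks⁻¹ s
    ... | i , refl = suc i , sym (+-suc j i)

    sat-□ : ∀ {φ : Form nAP nΣ n} {j} → sat (□ φ) Π j ⇔ (∀ i → sat φ Π (j + i))
    sat-□ {φ} = mk⇔ (λ f i → f _ (ticks i))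
      (λ f k s → subst (sat φ Π) (sym (proj₂ (ticks⁻¹ s))) (f (proj₁ (ticks⁻¹ s))))

    sat-⋀ : ∀ {f : Fin m → Form nAP nΣ n} {j} → sat (⋀ f) Π j ⇔ (∀ i → sat (f i) Π j)
    sat-⋀ = mk⇔ elim intro where
      elim : ∀ {m} {f : Fin m → Form nAP nΣ n} {j} → sat (⋀ f) Π j → ∀ i → sat (f i) Π j
      elim p fzero    = proj₁ p
      elim p (fsuc i) = elim (proj₂ p) i
      intro : ∀ {m} {f : Fin m → Form nAP nΣ n} {j} → (∀ i → sat (f i) Π j) → sat (⋀ f) Π j
      intro {zero}  p = sat-⊤
      intro {suc m} p = p fzero , intro (p ∘ fsuc)

    sat-⋀ᵛ : ∀ {k} {f : Vec (Fin m) k → Form nAP nΣ n} {j} → sat (⋀ᵛ f) Π j ⇔ (∀ v → sat (f v) Π j)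
    sat-⋀ᵛ = mk⇔ elim intro where
      elim : ∀ {m k} {f : Vec (Fin m) k → Form nAP nΣ n} {j} → sat (⋀ᵛ f) Π j → ∀ v → sat (f v) Π j
      elim p []      = p
      elim {f = f} p (a ∷ v) = elim {f = λ v → f (a ∷ v)} (to sat-⋀ p a) v
      intro : ∀ {m k} {f : Vec (Fin m) k → Form nAP nΣ n} {j} → (∀ v → sat (f v) Π j) → sat (⋀ᵛ f) Π j
      intro {k = zero}  p = p []
      intro {k = suc k} {f} p = from sat-⋀ λ a → intro {f = λ v → f (a ∷ v)} (λ v → p (a ∷ v))

-- Blank-padded stacks and the formulas that spell them

-- A list is a stack continued by infinitely many blanks (the symbol 0).

at : List (Fin (suc m)) → ℕ → Fin (suc m)
at []      _       = fzero
at (a ∷ l) zero    = a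
at (a ∷ l) (suc j) = at l j

at-drop : ∀ d (l : List (Fin (suc m))) j → at (drop d l) j ≡ at l (d + j)
at-drop zero    l       j = refl
at-drop (suc d) []      j = refl
at-drop (suc d) (a ∷ l) j = at-drop d l j

at-++ˡ : ∀ (u l : List (Fin (suc m))) p → at (u ++ l) (toℕ p) ≡ lookup u p
at-++ˡ (a ∷ u) l fzero    = refl
at-++ˡ (a ∷ u) l (fsuc p) = at-++ˡ u l p

at-++ʳ : ∀ (u l : List (Fin (suc m))) j → at (u ++ l) (length u + j) ≡ at l j
at-++ʳ []      l j = refl
at-++ʳ (a ∷ u) l j = at-++ʳ u l j

data Position {A : Set} (u : List A) : ℕ → Set where
  inside : (p : Fin (length u)) → Position u (toℕ p)
  beyond : ∀ j → Position u (length u + j)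

position : ∀ {A : Set} (u : List A) j → Position u j
position []      j       = beyond j
position (a ∷ u) zero    = inside fzero
position (a ∷ u) (suc j) with position u j
... | inside p = inside (fsuc p)
... | beyond i = beyond i

spell : (Fin (suc m) → Form nAP nΣ n) → List (Fin (suc m)) → Form nAP nΣ n
spell lit []       = □ lit fzero
spell lit (a ∷ as) = lit a ∧f next (spell lit as)

sat-spell : ∀ {lit : Fin (suc m) → Form nAP nΣ n} {Π} as {j} →
            sat (spell lit as) Π j ⇔ (∀ i → sat (lit (at as i)) Π (j + i))
sat-spell {lit = lit} {Π} as = mk⇔ (elim as) (intro as) where
  elim : ∀ as {j} → sat (spell lit as) Π j → ∀ i → sat (lit (at as i)) Π (j + i)
  elim []       p i = to (sat-□ {φ = lit fzero}) p i
  elim (a ∷ as) {j} (p , _) zero rewrite +-identityʳ j = p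
  elim (a ∷ as) {j} (_ , p) (suc i) rewrite +-suc j i =
    elim as (to (sat-next (spell lit as)) p) i
  intro : ∀ as {j} → (∀ i → sat (lit (at as i)) Π (j + i)) → sat (spell lit as) Π j
  intro []       p = from (sat-□ {φ = lit fzero}) p
  intro (a ∷ as) {j} p =
    subst (sat (lit a) Π) (+-identityʳ j) (p 0) ,
    from (sat-next (spell lit as))
      (intro as λ i → subst (sat (lit (at as i)) Π) (+-suc j i) (p (suc i)))

spellBlock : (Fin (suc m) → Form nAP nΣ n) → Fin (suc m) → List Bool
spellBlock {nAP = nAP} {nΣ} {n} lit a = encℕ 2 ++ encForm (lit a) ++ encℕ 5 ++ encProg (tick {nAP} {nΣ} {n})

-- Codes are in prefix notation: the tags, the literal and `tick` all precede the rest of the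
-- formula, and nothing follows it. Each letter thus contributes a block that depends on that letter
-- alone.
encForm-spell : ∀ (lit : Fin (suc m) → Form nAP nΣ n) as →
  encForm (spell lit as) ≡ concatMap (spellBlock lit) as ++ encForm (□ lit fzero)
encForm-spell lit [] = refl
encForm-spell {nAP = nAP} {nΣ} {n} lit (a ∷ as) = begin
  encℕ 2 ++ L ++ encℕ 5 ++ N ++ encForm (spell lit as)
    ≡⟨ cong (λ z → encℕ 2 ++ L ++ encℕ 5 ++ N ++ z) (encForm-spell lit as) ⟩
  encℕ 2 ++ L ++ (encℕ 5 ++ N ++ C ++ E)
    ≡⟨ cong (λ z → encℕ 2 ++ L ++ encℕ 5 ++ z) (++-assoc N C E) ⟨
  encℕ 2 ++ L ++ (encℕ 5 ++ (N ++ C) ++ E)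
    ≡⟨ cong (λ z → encℕ 2 ++ L ++ z) (++-assoc (encℕ 5) (N ++ C) E) ⟨
  encℕ 2 ++ L ++ (encℕ 5 ++ (N ++ C)) ++ E
    ≡⟨ cong (encℕ 2 ++_) (++-assoc L (encℕ 5 ++ N ++ C) E) ⟨
  encℕ 2 ++ (L ++ (encℕ 5 ++ N ++ C)) ++ E
    ≡⟨ cong (λ z → encℕ 2 ++ z ++ E) (++-assoc L (encℕ 5 ++ N) C) ⟨
  encℕ 2 ++ ((L ++ (encℕ 5 ++ N)) ++ C) ++ E ∎
  where
  open ≡-Reasoning
  L = encForm (lit a)
  N = encProg (tick {nAP} {nΣ} {n})
  C = concatMap (spellBlock lit) as
  E = encForm (□ lit fzero)

-- The quantifier prefix

∃∀∃ : Vec Quant 3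
∃∀∃ = ∃q ∷ ∀q ∷ ∃q ∷ []

Extends : (t₀ t₁ t₂ : Trace nAP nΣ) → Assignment nAP nΣ 3 → Set
Extends t₀ t₁ t₂ Π = (Π fzero ≡ t₀) × (Π (fsuc fzero) ≡ t₁) × (Π (fsuc (fsuc fzero)) ≡ t₂)

module _ {T : Trace nAP nΣ → Set} {P : Assignment nAP nΣ 3 → Set} where

  ∃∀∃-elim : evalPrefix T ∃∀∃ P → Σ (Trace nAP nΣ) λ t₀ → T t₀ ×
    (∀ t₁ → T t₁ → Σ (Trace nAP nΣ) λ t₂ → T t₂ × Σ (Assignment nAP nΣ 3) λ Π → Extends t₀ t₁ t₂ Π × P Π)
  ∃∀∃-elim (t₀ , Tt₀ , F) = t₀ , Tt₀ , λ t₁ Tt₁ →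
    let (t₂ , Tt₂ , p) = F t₁ Tt₁ in t₂ , Tt₂ , _ , (refl , refl , refl) , p

  ∃∀∃-intro : ∀ t₀ → T t₀ →
    (∀ t₁ → T t₁ → Σ (Trace nAP nΣ) λ t₂ → T t₂ × (∀ Π → Extends t₀ t₁ t₂ Π → P Π)) →
    evalPrefix T ∃∀∃ P
  ∃∀∃-intro t₀ Tt₀ F = t₀ , Tt₀ , λ t₁ Tt₁ →
    let (t₂ , Tt₂ , p) = F t₁ Tt₁ in t₂ , Tt₂ , p _ (refl , refl , refl)

-- Configurations as traces

module Configuration (nQ nΓ k : ℕ) where

  Γ : Set
  Γ = Fin (suc nΓ)

  -- (d , u) pops d symbols and pushes u, leaving the first symbol of u on top.
  Op : Set
  Op = ℕ × List Γ

  Outcome : Set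
  Outcome = Bool ⊎ (Fin nQ × Vec Op k)

  nProps : ℕ
  nProps = nQ + k * suc nΓ

  Fm : Set
  Fm = Form nProps 1 3

  statePr : Fin nQ → Fin nProps
  statePr q = q ↑ˡ _

  symPr : Fin k → Γ → Fin nProps
  symPr i a = nQ ↑ʳ combine i a

  -- t may satisfy further propositions: the formulas below only propagate truth
  -- forward, so exactness is never needed to follow a run inside a model.
  Covers : Trace nProps 1 → Fin nQ → Vec (List Γ) k → Set
  Covers t q ls = (props t 0 (statePr q) ≡ true) ×
                  (∀ i j → props t j (symPr i (at (lookupᵛ ls i) j)) ≡ true)

  holds : Vec (List Γ) k → ℕ → Fin k × Γ → Bool
  holds ls j (i , a) = does (a Fin.≟ at (lookupᵛ ls i) j)

  -- Stacks run along the time axis: cell `j` of each stack is written at position `j`. A single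
  -- program letter suffices, as all data sits in the propositions.
  traceOf : Fin nQ → Vec (List Γ) k → Trace nProps 1
  prog  (traceOf q ls) j   = fzero
  props (traceOf q ls) j p =
    [ (λ q′ → does (q′ Fin.≟ q)) , holds ls j ∘ remQuot (suc nΓ) ]′ (splitAt nQ p)

  props-state : ∀ q ls j q′ → props (traceOf q ls) j (statePr q′) ≡ does (q′ Fin.≟ q)
  props-state q ls j q′ rewrite splitAt-↑ˡ nQ q′ (k * suc nΓ) = refl

  props-sym : ∀ q ls j i a → props (traceOf q ls) j (symPr i a) ≡ does (a Fin.≟ at (lookupᵛ ls i) j)
  props-sym q ls j i a rewrite splitAt-↑ʳ nQ (k * suc nΓ) (combine i a) =
    cong (holds ls j) (remQuot-combine i a)

  does⇒ : ∀ {P : Set} (d : Dec P) → does d ≡ true → P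
  does⇒ (yes p) _ = p

  traceOf-covers : ∀ q ls → Covers (traceOf q ls) q ls
  traceOf-covers q ls =
    trans (props-state q ls 0 q) (dec-true (q Fin.≟ q) refl) ,
    λ i j → trans (props-sym q ls j i _) (dec-true (at (lookupᵛ ls i) j Fin.≟ _) refl)

-- Stack machines, their step formula and its correctness

module Machine {nQ nΓ k : ℕ}
  (rule : Fin nQ → Vec (Fin (suc nΓ)) k → Configuration.Outcome nQ nΓ k) where

  open Configuration nQ nΓ k

  heads : Vec (List Γ) k → Vec Γ k
  heads = mapᵛ (λ l → at l 0)

  exec : Op → List Γ → List Γ
  exec (d , u) l = u ++ drop d l

  data Halts : Fin nQ → Vec (List Γ) k → Bool → Set where
    stop : ∀ {q ls b} → rule q (heads ls) ≡ inj₁ b → Halts q ls b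
    move : ∀ {q ls q′ ops b} → rule q (heads ls) ≡ inj₂ (q′ , ops) →
           Halts q′ (zipWith exec ops ls) b → Halts q ls b

  π₁ π₂ : Fin 3
  π₁ = fsuc fzero
  π₂ = fsuc (fsuc fzero)

  pushF : Fin k → List Γ → Fm
  pushF i u = ⋀ λ p → next^ (toℕ p) (atom (symPr i (lookup u p)) π₂)

  -- Below the popped part, cell `d + j` becomes cell `length u + j`. Both traces advance together
  -- under the box, so the shift comes from unequal numbers of `next`.
  keepF : Fin k → Op → Γ → Fm
  keepF i (d , u) a =
    next^ d (atom (symPr i a) π₁) ⇒f next^ (length u) (atom (symPr i a) π₂)

  opF : Fin k → Op → Fm
  opF i op = pushF i (proj₂ op) ∧f (□ ⋀ (keepF i op))

  -- An accepting configuration admits no successor, which is how acceptance destroys every model; a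
  -- rejecting one may have any successor.
  actionF : Outcome → Fm
  actionF (inj₁ true)       = ⊥f
  actionF (inj₁ false)      = ⊤f
  actionF (inj₂ (q , ops)) = atom (statePr q) π₂ ∧f ⋀ λ i → opF i (lookupᵛ ops i)

  headsF : Vec Γ k → Fm
  headsF v = ⋀ λ i → atom (symPr i (lookupᵛ v i)) π₁

  ruleF : Fin nQ → Vec Γ k → Fm
  ruleF q v = (atom (statePr q) π₁ ∧f headsF v) ⇒f actionF (rule q v)

  stepF : Fm
  stepF = ⋀ λ q → ⋀ᵛ λ v → ruleF q v

  module _ {Π : Assignment nProps 1 3} where

    sat-keepF : ∀ i d u a {j} → sat (keepF i (d , u) a) Π j ⇔
      (props (Π π₁) (d + j) (symPr i a) ≡ true → props (Π π₂) (length u + j) (symPr i a) ≡ true)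
    sat-keepF i d u a {j} = mk⇔
      (λ f p → to (sat-next^ (length u) A₂) (to (sat-⇒ {φ = next^ d A₁}) f (from (sat-next^ d A₁) p)))
      (λ f → from (sat-⇒ {φ = next^ d A₁}) λ p → from (sat-next^ (length u) A₂) (f (to (sat-next^ d A₁) p)))
      where
      A₁ A₂ : Fm
      A₁ = atom (symPr i a) π₁
      A₂ = atom (symPr i a) π₂

    opF-sound : ∀ i op l → sat (opF i op) Π 0 →
      (∀ j → props (Π π₁) j (symPr i (at l j)) ≡ true) →
      ∀ j → props (Π π₂) j (symPr i (at (exec op l) j)) ≡ true
    opF-sound i (d , u) l (pushed , kept) cov j with position u j
    ... | inside p rewrite at-++ˡ u (drop d l) p =
      subst (λ z → props (Π π₂) z (symPr i (lookup u p)) ≡ true) (+-identityʳ (toℕ p))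
        (to (sat-next^ (toℕ p) (atom (symPr i (lookup u p)) π₂))
          (to (sat-⋀ {f = λ p → next^ (toℕ p) (atom (symPr i (lookup u p)) π₂)}) pushed p))
    ... | beyond m rewrite at-++ʳ u (drop d l) m | at-drop d l m =
      to (sat-keepF i d u (at l (d + m)))
        (to (sat-⋀ {f = keepF i (d , u)}) (to (sat-□ {φ = ⋀ (keepF i (d , u))}) kept m) (at l (d + m)))
        (cov (d + m))

    -- Exactness is asked of `π₁` only: a spurious symbol there would have to be copied to `π₂`,
    -- where covering the new stack is enough.
    opF-complete : ∀ i op l →
      (∀ j a → props (Π π₁) j (symPr i a) ≡ true → a ≡ at l j) →
      (∀ j → props (Π π₂) j (symPr i (at (exec op l) j)) ≡ true) →
      sat (opF i op) Π 0
    opF-complete i (d , u) l exact cov =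
      from (sat-⋀ {f = λ p → next^ (toℕ p) (atom (symPr i (lookup u p)) π₂)}) (λ p →
        from (sat-next^ (toℕ p) (atom (symPr i (lookup u p)) π₂))
          (subst (λ z → props (Π π₂) z (symPr i (lookup u p)) ≡ true) (sym (+-identityʳ (toℕ p)))
            (subst (λ a → props (Π π₂) (toℕ p) (symPr i a) ≡ true) (at-++ˡ u (drop d l) p) (cov (toℕ p))))) ,
      from (sat-□ {φ = ⋀ (keepF i (d , u))}) λ m → from (sat-⋀ {f = keepF i (d , u)}) λ a →
        from (sat-keepF i d u a) λ h →
          subst (λ a → props (Π π₂) (length u + m) (symPr i a) ≡ true)
            (trans (at-++ʳ u (drop d l) m) (trans (at-drop d l m) (sym (exact (d + m) a h))))
            (cov (length u + m))

    sat-stepF : sat stepF Π 0 ⇔ (∀ q v → props (Π π₁) 0 (statePr q) ≡ true →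
      (∀ i → props (Π π₁) 0 (symPr i (lookupᵛ v i)) ≡ true) → sat (actionF (rule q v)) Π 0)
    sat-stepF = mk⇔
      (λ s q v p h → to (sat-⇒ {φ = atom (statePr q) π₁ ∧f headsF v})
        (to (sat-⋀ᵛ {f = ruleF q}) (to (sat-⋀ {f = λ q → ⋀ᵛ (ruleF q)}) s q) v)
        (p , from (sat-⋀ {f = λ i → atom (symPr i (lookupᵛ v i)) π₁}) h))
      (λ s → from (sat-⋀ {f = λ q → ⋀ᵛ (ruleF q)}) λ q → from (sat-⋀ᵛ {f = ruleF q}) λ v →
        from (sat-⇒ {φ = atom (statePr q) π₁ ∧f headsF v}) λ (p , h) →
          s q v p (to (sat-⋀ {f = λ i → atom (symPr i (lookupᵛ v i)) π₁}) h))

    stepF-sound : ∀ {q ls} → sat stepF Π 0 → Covers (Π π₁) q ls →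
                  sat (actionF (rule q (heads ls))) Π 0
    stepF-sound {q} {ls} s (p , h) = to sat-stepF s q (heads ls) p λ i →
      subst (λ a → props (Π π₁) 0 (symPr i a) ≡ true) (sym (lookup-map i _ ls)) (h i 0)

    actionF-sound : ∀ {q ls q′ ops} → sat (actionF (inj₂ (q′ , ops))) Π 0 →
                    Covers (Π π₁) q ls → Covers (Π π₂) q′ (zipWith exec ops ls)
    actionF-sound {ls = ls} {ops = ops} (p , s) (_ , h) = p , λ i j →
      subst (λ l → props (Π π₂) j (symPr i (at l j)) ≡ true) (sym (lookup-zipWith exec i ops ls))
        (opF-sound i (lookupᵛ ops i) (lookupᵛ ls i)
          (to (sat-⋀ {f = λ i → opF i (lookupᵛ ops i)}) s i) (h i) j)

    actionF-complete : ∀ {q ls q′ ops} → Π π₁ ≡ traceOf q ls → Π π₂ ≡ traceOf q′ (zipWith exec ops ls) →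
                       sat (actionF (inj₂ (q′ , ops))) Π 0
    actionF-complete {q} {ls} {q′} {ops} e₁ e₂ =
      proj₁ cov , from (sat-⋀ {f = λ i → opF i (lookupᵛ ops i)}) λ i →
        opF-complete i (lookupᵛ ops i) (lookupᵛ ls i)
          (λ j a h → does⇒ (a Fin.≟ _) (trans (sym (props-sym q ls j i a))
             (subst (λ t → props t j (symPr i a) ≡ true) e₁ h)))
          (λ j → subst (λ l → props (Π π₂) j (symPr i (at l j)) ≡ true)
             (lookup-zipWith exec i ops ls) (proj₂ cov i j))
      where
      cov : Covers (Π π₂) q′ (zipWith exec ops ls)
      cov = subst (λ t → Covers t q′ (zipWith exec ops ls)) (sym e₂)
              (traceOf-covers q′ (zipWith exec ops ls))

    -- A `traceOf` trace shows one state and one top symbol per stack, so every other rule holds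
    -- vacuously.
    stepF-complete : ∀ {q ls} → Π π₁ ≡ traceOf q ls →
                     sat (actionF (rule q (heads ls))) Π 0 → sat stepF Π 0
    stepF-complete {q} {ls} e s = from sat-stepF λ q′ v p h →
      subst₂ (λ q v → sat (actionF (rule q v)) Π 0)
        (sym (does⇒ (q′ Fin.≟ q) (trans (sym (props-state q ls 0 q′))
           (subst (λ t → props t 0 (statePr q′) ≡ true) e p))))
        (sym (Pointwise-≡⇒≡ (extensional⇒inductive (ext λ i → trans
           (does⇒ (lookupᵛ v i Fin.≟ _) (trans (sym (props-sym q ls 0 i (lookupᵛ v i)))
             (subst (λ t → props t 0 (symPr i (lookupᵛ v i)) ≡ true) e (h i))))
           (sym (lookup-map i _ ls))))))
        s

  module _ {T : Trace nProps 1 → Set} where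

    -- Induction on the run: closure supplies a member of `T` covering each next configuration,
    -- until the accepting one demands falsity.
    no-accepting-run :
      (∀ t₁ → T t₁ → Σ (Trace nProps 1) λ t₂ → T t₂ ×
        Σ (Assignment nProps 1 3) λ Π → (Π π₁ ≡ t₁) × (Π π₂ ≡ t₂) × sat stepF Π 0) →
      ∀ {q ls} → Halts q ls true → ∀ t → T t → ¬ Covers t q ls
    no-accepting-run closed (stop e) t Tt cov with closed t Tt
    ... | _ , _ , Π , refl , refl , s =
      subst (λ r → sat (actionF r) Π 0) e (stepF-sound s cov) (sat-⊤ {Π = Π} {0})
    no-accepting-run closed {ls = ls} (move {ops = ops} e h) t Tt cov with closed t Tt
    ... | t₂ , Tt₂ , Π , refl , refl , s =
      no-accepting-run closed h t₂ Tt₂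
        (actionF-sound {ls = ls} {ops = ops} (subst (λ r → sat (actionF r) Π 0) e (stepF-sound s cov)) cov)

  -- The model consists of all configurations that lead to rejection, so closure under successors
  -- amounts to taking the tail of a run.
  Rejecting : Trace nProps 1 → Set
  Rejecting t = Σ (Fin nQ) λ q → Σ (Vec (List Γ) k) λ ls → Halts q ls false × (t ≡ traceOf q ls)

  Rejecting-closed : ∀ t₁ → Rejecting t₁ → Σ (Trace nProps 1) λ t₂ → Rejecting t₂ ×
    (∀ Π → Π π₁ ≡ t₁ → Π π₂ ≡ t₂ → sat stepF Π 0)
  -- Rejection imposes nothing on the successor, so the trace itself is chosen.
  Rejecting-closed t₁ r@(q , ls , stop e , refl) = t₁ , r , λ Π e₁ _ →
    stepF-complete e₁ (subst (λ r → sat (actionF r) Π 0) (sym e) (sat-⊤ {Π = Π}))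
  Rejecting-closed t₁ (q , ls , move {q′ = q′} {ops} e h , refl) =
    traceOf q′ ls′ , (q′ , ls′ , h , refl) , λ Π e₁ e₂ →
      stepF-complete e₁ (subst (λ r → sat (actionF r) Π 0) (sym e)
        (actionF-complete {ls = ls} {ops = ops} e₁ e₂))
    where
    ls′ = zipWith exec ops ls

-- The three-stage machine

module Diagonal (M : TM) where

  open TM M
  open Configuration (3 + nStates) (2 + nExtra) 3

  bits : List Bool → List Γ
  bits = map (encBit M)

  pattern expanding = fzero
  pattern rewinding = fsuc fzero
  pattern running q = fsuc (fsuc q)

  -- Stack 0 is the tape left of the head and stack 1 the tape from the head on;
  -- stack 2 is the copy of tailCode consumed while expanding.
  leftF bothF : Γ → Fm
  leftF a = atom (symPr fzero a) fzero
  bothF a = atom (symPr (fsuc fzero) a) fzero ∧f atom (symPr (fsuc (fsuc fzero)) a) fzero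

  -- The image of one letter under the map h of the quine. `bothF` fills stacks 1 and 2 together, so
  -- the word is spelled only once in the formula.
  block : Γ → List Bool
  block = spellBlock bothF

  -- The part A of the code; its last `encℕ 2` is the tag of the outermost conjunction of
  -- `diagonalF`.
  preamble : List Bool
  preamble = encℕ nProps ++ encℕ 1 ++ encℕ 3 ++ encVec encQuant ∃∀∃ ++ encℕ 2

  keep pop : Op
  keep = 0 , []
  pop  = 1 , []

  -- A left move carries `l`, the old top of the left stack, to the right stack above the written
  -- `a`. On an empty stack `l` is blank, as on the tape.
  moveOps : Γ → Γ → Move → Vec Op 3
  moveOps l a left  = pop ∷ (1 , l ∷ a ∷ []) ∷ keep ∷ []
  moveOps l a right = (0 , a ∷ []) ∷ pop ∷ keep ∷ []
  moveOps l a stay  = keep ∷ (1 , a ∷ []) ∷ keep ∷ []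

  actionRule : Γ → Action (suc nStates) (3 + nExtra) → Outcome
  actionRule l (halt b)      = inj₁ b
  actionRule l (write q a m) = inj₂ (running q , moveOps l a m)

  -- A blank on top signals an exhausted stack, since encoded bits are never blank. Blocks are
  -- pushed reversed because stack 0 is read away from the head.
  rule : Fin (3 + nStates) → Vec Γ 3 → Outcome
  rule expanding   (_ ∷ _ ∷ fzero ∷ [])      = inj₂ (rewinding , keep ∷ keep ∷ keep ∷ [])
  rule expanding   (_ ∷ _ ∷ s@(fsuc _) ∷ []) =
    inj₂ (expanding , (0 , reverse (bits (block s))) ∷ keep ∷ pop ∷ [])
  rule rewinding   (fzero ∷ _ ∷ _ ∷ [])      = inj₂ (running fzero , keep ∷ keep ∷ keep ∷ [])
  rule rewinding   (l@(fsuc _) ∷ _ ∷ _ ∷ []) = inj₂ (rewinding , pop ∷ (0 , l ∷ []) ∷ keep ∷ [])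
  rule (running q) (l ∷ r ∷ _ ∷ [])          = actionRule l (δ q r)

  open Machine rule

  expand-halts : ∀ w {l r b} →
    Halts rewinding ((reverse (bits (concatMap block (bits w))) ++ l) ∷ r ∷ [] ∷ []) b →
    Halts expanding (l ∷ r ∷ bits w ∷ []) b
  expand-halts []      h = move refl h
  expand-halts (c ∷ w) {l} {r} {b} h = pushed c refl
    where
    C = concatMap block (bits w)
    assoc : reverse (bits (block (encBit M c) ++ C)) ++ l ≡
            reverse (bits C) ++ reverse (bits (block (encBit M c))) ++ l
    assoc = trans (cong (λ z → reverse z ++ l) (map-++ _ (block (encBit M c)) C))
              (trans (cong (_++ l) (reverse-++ (bits (block (encBit M c))) (bits C)))
                (++-assoc (reverse (bits C)) _ l))
    tail-halts : Halts expanding ((reverse (bits (block (encBit M c))) ++ l) ∷ r ∷ bits w ∷ []) b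
    tail-halts = expand-halts w (subst (λ z → Halts rewinding (z ∷ r ∷ [] ∷ []) b) assoc h)
    pushed : ∀ d → c ≡ d → Halts expanding (l ∷ r ∷ bits (c ∷ w) ∷ []) b
    pushed false refl = move refl tail-halts
    pushed true  refl = move refl tail-halts

  rewind-halts : ∀ v {r s b} →
    Halts (running fzero) ([] ∷ (reverse (bits v) ++ r) ∷ s ∷ []) b →
    Halts rewinding (bits v ∷ r ∷ s ∷ []) b
  rewind-halts []      h = move refl h
  rewind-halts (c ∷ v) {r} {s} {b} h = moved c refl
    where
    assoc : reverse (bits (c ∷ v)) ++ r ≡ reverse (bits v) ++ encBit M c ∷ r
    assoc = trans (cong (_++ r) (unfold-reverse (encBit M c) (bits v)))
              (++-assoc (reverse (bits v)) _ r)
    tail-halts : Halts rewinding (bits v ∷ (encBit M c ∷ r) ∷ s ∷ []) b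
    tail-halts = rewind-halts v (subst (λ z → Halts (running fzero) ([] ∷ z ∷ s ∷ []) b) assoc h)
    moved : ∀ d → c ≡ d → Halts rewinding (bits (c ∷ v) ∷ r ∷ s ∷ []) b
    moved false refl = move refl tail-halts
    moved true  refl = move refl tail-halts

  -- Two stacks as the tape of a Turing machine

  zipper : List Γ → List Γ → ℤ → Γ
  zipper l r (+ j)    = at r j
  zipper l r -[1+ j ] = at l j

  update-here : ∀ f h a → update M f h a h ≡ a
  update-here f h a with h ℤ.≟ h
  ... | yes _ = refl
  ... | no ¬p = ⊥-elim (¬p refl)

  update-there : ∀ f h a x → x ≢ h → update M f h a x ≡ f x
  update-there f h a x x≢h with x ℤ.≟ h
  ... | yes p = ⊥-elim (x≢h p)
  ... | no _  = refl

  offset≢ : ∀ h i → i ≢ + 0 → h +ℤ i ≢ h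
  offset≢ h i i≢0 = i≢0 ∘ identityʳ-unique h i

  -- Offsets are relative to the head, so only offset 0 denotes the written cell: `h +ℤ i` equals
  -- `h` only for `i` zero.
  zipper-update : ∀ {l r f h} a → (∀ i → zipper l r i ≡ f (h +ℤ i)) →
                  ∀ i → zipper l (a ∷ drop 1 r) i ≡ update M f h a (h +ℤ i)
  zipper-update {f = f} {h} a z (+ zero) =
    sym (trans (cong (update M f h a) (ℤₚ.+-identityʳ h)) (update-here f h a))
  zipper-update {r = r} {f} {h} a z i@(+ suc j) =
    trans (at-drop 1 r j) (trans (z i) (sym (update-there f h a _ (offset≢ h i λ ()))))
  zipper-update {f = f} {h} a z i@(-[1+ _ ]) =
    trans (z i) (sym (update-there f h a _ (offset≢ h i λ ())))

  zipper-left : ∀ l r i → zipper (drop 1 l) (at l 0 ∷ r) i ≡ zipper l r (-[1+ 0 ] +ℤ i)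
  zipper-left l r (+ zero)  = refl
  zipper-left l r (+ suc j) = refl
  zipper-left l r -[1+ j ]  = at-drop 1 l j

  zipper-right : ∀ a l r i → zipper (a ∷ l) r i ≡ zipper l (a ∷ r) (+ 1 +ℤ i)
  zipper-right a l r (+ j)        = refl
  zipper-right a l r -[1+ zero ]  = refl
  zipper-right a l r -[1+ suc j ] = refl

  -- The invariant compares tapes pointwise, relative to the head. A move reindexes the stacks, and
  -- associativity of addition absorbs the shift of `h`.
  simulate : ∀ n {q f h l r s b} → (∀ i → zipper l r i ≡ f (h +ℤ i)) →
             run M n (cfg q f h) ≡ inj₁ b → Halts (running q) (l ∷ r ∷ s ∷ []) b
  simulate (suc n) {q} {f} {h} {l} {r} {s} {b} z e with δ q (f h) in eq
  ... | halt b′ = stop (trans (cong (actionRule _ ∘ δ q) (trans (z (+ 0)) (cong f (ℤₚ.+-identityʳ h))))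
                         (trans (cong (actionRule _) eq) (cong inj₁ (inj₁-injective e))))
  ... | write q′ a m = move (trans (cong (actionRule _ ∘ δ q) (trans (z (+ 0)) (cong f (ℤₚ.+-identityʳ h))))
                              (cong (actionRule _) eq)) (after m e)
    where
    after : ∀ m → run M n (cfg q′ (update M f h a) (moveBy M m h)) ≡ inj₁ b →
            Halts (running q′) (zipWith exec (moveOps (at l 0) a m) (l ∷ r ∷ s ∷ [])) b
    after left  = simulate n λ i → trans (zipper-left l _ i)
      (trans (zipper-update {f = f} {h} a z (-[1+ 0 ] +ℤ i)) (cong (update M f h a) (sym (ℤₚ.+-assoc h -[1+ 0 ] i))))
    after right = simulate n λ i → trans (zipper-right a l _ i)
      (trans (zipper-update {f = f} {h} a z (+ 1 +ℤ i)) (cong (update M f h a) (sym (ℤₚ.+-assoc h (+ 1) i))))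
    after stay  = simulate n (zipper-update {f = f} {h} a z)

  zipper-input : ∀ w i → zipper [] (bits w) i ≡ inputTape M w (+ 0 +ℤ i)
  zipper-input []      (+ j)     = refl
  zipper-input (b ∷ w) (+ zero)  = refl
  zipper-input (b ∷ w) (+ suc j) = zipper-input w (+ j)
  zipper-input []      -[1+ j ]  = refl
  zipper-input (b ∷ w) -[1+ j ]  = refl

  -- The self-referential formula and the reduction

  initialF tailF : Fm
  initialF = atom (statePr expanding) fzero ∧f spell leftF (bits (reverse preamble))
  tailF    = initialF ∧f stepF

  -- The word B of the quine: the blank tail that ends the spelling, then `tailF`. The rules mention
  -- `block` but not this word, so the definition is not circular.
  tailCode : List Bool
  tailCode = encForm (□ bothF fzero) ++ encForm tailF

  diagonalF : Fm
  diagonalF = spell bothF (bits tailCode) ∧f tailF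

  diagonal : Instance
  diagonal = inst nProps 1 (lin 3 ∃∀∃ diagonalF)

  enc-diagonal : encInstance diagonal ≡ (preamble ++ concatMap block (bits tailCode)) ++ tailCode
  enc-diagonal = begin
    encInstance diagonal
      ≡⟨ ++-assoc (encℕ nProps) _ _ ⟨
    preamble ++ encForm (spell bothF (bits tailCode)) ++ encForm tailF
      ≡⟨ cong (λ z → preamble ++ z ++ encForm tailF) (encForm-spell bothF (bits tailCode)) ⟩
    preamble ++ (C ++ encForm (□ bothF fzero)) ++ encForm tailF
      ≡⟨ cong (preamble ++_) (++-assoc C _ _) ⟩
    preamble ++ C ++ tailCode
      ≡⟨ ++-assoc preamble C tailCode ⟨
    (preamble ++ C) ++ tailCode ∎
    where
    open ≡-Reasoning
    C = concatMap block (bits tailCode)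

  stacks₀ : Vec (List Γ) 3
  stacks₀ = bits (reverse preamble) ∷ bits tailCode ∷ bits tailCode ∷ []

  -- The phases are composed from last to first. Expansion leaves the reversed `preamble` and blocks
  -- on stack 0; rewinding puts them in front of `tailCode`, which yields the input tape.
  simulate-diagonal : ∀ {b} → HaltsWith M (encInstance diagonal) b → Halts expanding stacks₀ b
  simulate-diagonal {b} (n , e) = expand-halts tailCode
    (subst (λ l → Halts rewinding (l ∷ bits tailCode ∷ [] ∷ []) b) left≡
      (rewind-halts (reverse X)
        (subst (λ r → Halts (running fzero) ([] ∷ r ∷ [] ∷ []) b) right≡
          (simulate n (zipper-input (encInstance diagonal)) e))))
    where
    open ≡-Reasoning
    C = concatMap block (bits tailCode)
    X = preamble ++ C
    left≡ : bits (reverse X) ≡ reverse (bits C) ++ bits (reverse preamble)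
    left≡ = begin
      bits (reverse X)                          ≡⟨ cong bits (reverse-++ preamble C) ⟩
      bits (reverse C ++ reverse preamble)      ≡⟨ map-++ _ (reverse C) (reverse preamble) ⟩
      bits (reverse C) ++ bits (reverse preamble)
        ≡⟨ cong (_++ bits (reverse preamble)) (reverse-map _ C) ⟩
      reverse (bits C) ++ bits (reverse preamble) ∎
    right≡ : bits (encInstance diagonal) ≡ reverse (bits (reverse X)) ++ bits tailCode
    right≡ = begin
      bits (encInstance diagonal)               ≡⟨ cong bits enc-diagonal ⟩
      bits (X ++ tailCode)                      ≡⟨ map-++ _ X tailCode ⟩
      bits X ++ bits tailCode
        ≡⟨ cong (λ z → bits z ++ bits tailCode) (reverse-involutive X) ⟨
      bits (reverse (reverse X)) ++ bits tailCode
        ≡⟨ cong (_++ bits tailCode) (reverse-map _ (reverse X)) ⟩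
      reverse (bits (reverse X)) ++ bits tailCode ∎

  module _ {Π : Assignment nProps 1 3} where

    initial-sound : sat (spell bothF (bits tailCode)) Π 0 → sat initialF Π 0 →
                    Covers (Π fzero) expanding stacks₀
    initial-sound both (p , lefts) = p , λ where
      fzero               → to (sat-spell {lit = leftF} (bits (reverse preamble))) lefts
      (fsuc fzero)        → proj₁ ∘ to (sat-spell {lit = bothF} (bits tailCode)) both
      (fsuc (fsuc fzero)) → proj₂ ∘ to (sat-spell {lit = bothF} (bits tailCode)) both

    initial-complete : Covers (Π fzero) expanding stacks₀ →
                       sat (spell bothF (bits tailCode)) Π 0 × sat initialF Π 0
    initial-complete (p , c) =
      from (sat-spell {lit = bothF} (bits tailCode)) (λ j → c (fsuc fzero) j , c (fsuc (fsuc fzero)) j) ,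
      p , from (sat-spell {lit = leftF} (bits (reverse preamble))) (c fzero)

  satisfiable⇒¬accepted : Satisfiable diagonal → ¬ HaltsWith M (encInstance diagonal) true
  satisfiable⇒¬accepted (T , _ , T⊨φ) halts =
    let (t₀ , Tt₀ , F) = ∃∀∃-elim {T = T} {λ Π → sat diagonalF Π 0} T⊨φ
        -- The conditions on π₀ stand under the other quantifiers, so π₁ is instantiated with `t₀`
        -- to reach them.
        (_ , _ , Π , (e₀ , _) , both , init , _) = F t₀ Tt₀
    in no-accepting-run {T}
         (λ t₁ Tt₁ → let (t₂ , Tt₂ , Π , (_ , e₁ , e₂) , _ , _ , s) = F t₁ Tt₁
                     in t₂ , Tt₂ , Π , e₁ , e₂ , s)
         (simulate-diagonal halts) t₀ Tt₀
         (subst (λ t → Covers t expanding stacks₀) e₀ (initial-sound {Π} both init))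

  rejected⇒satisfiable : HaltsWith M (encInstance diagonal) false → Satisfiable diagonal
  rejected⇒satisfiable halts = Rejecting , (t₀ , r₀) ,
    ∃∀∃-intro {T = Rejecting} {λ Π → sat diagonalF Π 0} t₀ r₀ λ t₁ r₁ →
      let (t₂ , r₂ , s) = Rejecting-closed t₁ r₁
      in t₂ , r₂ , λ Π (e₀ , e₁ , e₂) →
        let (both , init) = initial-complete {Π}
              (subst (λ t → Covers t expanding stacks₀) (sym e₀) (traceOf-covers expanding stacks₀))
        in both , init , s Π e₁ e₂
    where
    t₀ : Trace nProps 1
    t₀ = traceOf expanding stacks₀
    r₀ : Rejecting t₀
    r₀ = expanding , stacks₀ , simulate-diagonal halts , refl

theorem12 : Undecidable Satisfiable
-- Each verdict refutes itself. A model would make `M` accept, which rules models out; so there is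
-- none, `M` rejects, and that yields a model.
theorem12 (M , decides) = ¬sat (rejected⇒satisfiable (proj₂ (decides diagonal) ¬sat))
  where
  open Diagonal M
  ¬sat : ¬ Satisfiable diagonal
  ¬sat s = satisfiable⇒¬accepted s (proj₁ (decides diagonal) s)
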